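{- Every three-valued Łukasiewicz algebra $A$ can be represented as an algebra of rough subsets of an approximation space $(Ob, R_{Ob})$. Here $Ob$ is the set of all prime filters of $A$, and $R_{Ob}$ is the equivalence relation on $Ob$ given by: $P\, R_{Ob}\, Q$ if and only if $P$ and $Q$ are comparable, i.e. $P \subseteq Q$ or $Q \subseteq P$. "Represented" means that $A$ is isomorphic, as a three-valued Łukasiewicz algebra, to a subalgebra of the algebra of all rough sets of $(Ob, R_{Ob})$.
   Context: A De Morgan algebra $(A, \wedge, \vee, \sim, 1)$ is a distributive lattice $(A, \wedge, \vee)$ with greatest element $1$ and a unary operation $\sim$ satisfying $\sim\sim x = x$ and $\sim(x \wedge y) = \sim x\ \vee \sim y$; its least element is $0 = \sim 1$. A three-valued Łukasiewicz algebra is an algebra $(A, \wedge, \vee, \sim, \bigtriangledown, 1)$ of type $(2,2,1,1,0)$ such that $(A, \wedge, \vee, \sim, 1)$ is a De Morgan algebra and, for all $x, y \in A$: $\sim x \vee \bigtriangledown x = 1$; $x\, \wedge \sim x = \ \sim x \wedge \bigtriangledown x$; $\bigtriangledown(x \wedge y) = \bigtriangledown x \wedge \bigtriangledown y$. Homomorphisms, isomorphisms and subalgebras are with respect to the operations $\wedge, \vee, \sim, \bigtriangledown, 1$. Prime filters are proper. It is known that the set of prime filters of a three-valued Łukasiewicz algebra, ordered by inclusion, is a disjoint union of chains of one or two elements (elements of different chains being incomparable), so that the comparability relation $R_{Ob}$ is an equivalence relation. Throughout, the set of objects $Ob$ is assumed to be nonempty. An approximation space is a pair $(Ob, R)$ where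 $Ob$ is a nonempty set and $R$ is an equivalence relation on $Ob$; $R^{\ast}$ is the set of its equivalence classes. For $X \subseteq Ob$ write $\neg X = Ob \setminus X$ and $$MX = \bigcup \{C \in R^{\ast} : C \cap X \neq \emptyset\}, \qquad LX = \neg M \neg X = \bigcup \{C \in R^{\ast} : C \subseteq X\}.$$ A rough set (rough subset) of $(Ob,R)$ is a pair $(LX, MX)$ with $X \subseteq Ob$. The collection $\{(LX,MX) : X \subseteq Ob\}$ of all rough sets is a three-valued Łukasiewicz algebra under the operations $$(LX, MX) \wedge (LY, MY) = (LX \cap LY,\ MX \cap MY),$$ $$(LX, MX) \vee (LY, MY) = (LX \cup LY,\ MX \cup MY),$$ $$\sim (LX, MX) = (L \neg X,\ M \neg X), \qquad \bigtriangledown (LX, MX) = (MX, MX),$$ $$0 = (\emptyset, \emptyset), \qquad 1 = (Ob, Ob).$$ An algebra of rough subsets of $(Ob,R)$ means a subalgebra of this algebra. -}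

module Defs where

open import Algebra.Core using (Op₁; Op₂)
import Algebra.Definitions as AlgebraDefinitions
open import Algebra.Lattice.Bundles using (DistributiveLattice)
open import Algebra.Lattice.Morphism.Structures using (IsLatticeHomomorphism)
import Algebra.Lattice.Properties.DistributiveLattice as DistributiveLatticeProperties
open import Algebra.Lattice.Structures using (IsDistributiveLattice)
open import Axiom.ExcludedMiddle using (ExcludedMiddle)
open import Data.Empty using (⊥-elim)
open import Data.Product using (∃; _×_; _,_; proj₁; proj₂; swap)
open import Data.Sum using (_⊎_; inj₁; inj₂; [_,_]′)
open import Data.Unit.Polymorphic using (tt) renaming (⊤ to Unit)
open import Function using (_∘_; id)
open import Function.Definitions using (Injective; Surjective)
open import Level using (Level; _⊔_; suc)
open import Relation.Binary.Bundles using (Setoid; Poset)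
open import Relation.Binary.Core using (Rel; _⇒_)
open import Relation.Binary.Definitions using (Transitive; _Respects_)
import Relation.Binary.Lattice as OrderLattice
open import Relation.Binary.Structures using (IsEquivalence)
open import Relation.Nullary using (¬_; yes; no)
open import Relation.Nullary.Decidable using (decidable-stable)
open import Relation.Unary
  using (Pred; _∈_; _∉_; _⊆_; _≐_; _∩_; _∪_; ∁; _≬_; Satisfiable; Universal)

private
  variable
    a b c ℓ o e r p ℓ₁ ℓ₂ : Level

record IsDeMorganAlgebra {A : Set a} (_≈_ : Rel A ℓ)
         (_∨_ _∧_ : Op₂ A) (∼_ : Op₁ A) (⊤ : A) : Set (a ⊔ ℓ) where
  open AlgebraDefinitions _≈_
  field
    isDistributiveLattice : IsDistributiveLattice _≈_ _∨_ _∧_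
    ∧-identityʳ           : RightIdentity ⊤ _∧_  -- ⊤ is the greatest element
    ∼-cong                : Congruent₁ ∼_
    ∼-involutive          : Involutive ∼_
    deMorgan              : ∀ x y → (∼ (x ∧ y)) ≈ ((∼ x) ∨ (∼ y))

  open IsDistributiveLattice isDistributiveLattice public

record IsŁukasiewiczAlgebra₃ {A : Set a} (_≈_ : Rel A ℓ)
         (_∨_ _∧_ : Op₂ A) (∼_ ∇_ : Op₁ A) (⊤ : A) : Set (a ⊔ ℓ) where
  open AlgebraDefinitions _≈_
  field
    isDeMorganAlgebra : IsDeMorganAlgebra _≈_ _∨_ _∧_ ∼_ ⊤
    ∇-cong            : Congruent₁ ∇_
    ∼∨∇               : ∀ x → ((∼ x) ∨ (∇ x)) ≈ ⊤
    ∧∼                : ∀ x → (x ∧ (∼ x)) ≈ ((∼ x) ∧ (∇ x))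
    ∇-∧               : ∀ x y → (∇ (x ∧ y)) ≈ ((∇ x) ∧ (∇ y))

  open IsDeMorganAlgebra isDeMorganAlgebra public

record ŁukasiewiczAlgebra₃ c ℓ : Set (suc (c ⊔ ℓ)) where
  infix  8 ∼_ ∇_
  infixr 7 _∧_
  infixr 6 _∨_
  infix  4 _≈_
  field
    Carrier              : Set c
    _≈_                  : Rel Carrier ℓ
    _∨_                  : Op₂ Carrier
    _∧_                  : Op₂ Carrier
    ∼_                   : Op₁ Carrier
    ∇_                   : Op₁ Carrier
    ⊤                    : Carrier
    isŁukasiewiczAlgebra₃ : IsŁukasiewiczAlgebra₃ _≈_ _∨_ _∧_ ∼_ ∇_ ⊤

  open IsŁukasiewiczAlgebra₃ isŁukasiewiczAlgebra₃ public

  distributiveLattice : DistributiveLattice c ℓ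
  distributiveLattice = record { isDistributiveLattice = isDistributiveLattice }

  open DistributiveLattice distributiveLattice public
    using (setoid; lattice; rawLattice)

  open Poset (DistributiveLatticeProperties.poset distributiveLattice) public
    using (_≤_)

module _ (A : ŁukasiewiczAlgebra₃ a ℓ₁) (B : ŁukasiewiczAlgebra₃ b ℓ₂) where
  private
    module A = ŁukasiewiczAlgebra₃ A
    module B = ŁukasiewiczAlgebra₃ B

  record IsŁukasiewiczHomomorphism (f : A.Carrier → B.Carrier)
           : Set (a ⊔ b ⊔ ℓ₁ ⊔ ℓ₂) where
    field
      isLatticeHomomorphism : IsLatticeHomomorphism A.rawLattice B.rawLattice f
      ∼-homo                : ∀ x → f (A.∼ x) B.≈ B.∼ (f x)
      ∇-homo                : ∀ x → f (A.∇ x) B.≈ B.∇ (f x)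
      ⊤-homo                : f A.⊤ B.≈ B.⊤

  record IsŁukasiewiczIsomorphism (f : A.Carrier → B.Carrier)
           : Set (a ⊔ b ⊔ ℓ₁ ⊔ ℓ₂) where
    field
      isŁukasiewiczHomomorphism : IsŁukasiewiczHomomorphism f
      injective                 : Injective A._≈_ B._≈_ f
      surjective                : Surjective A._≈_ B._≈_ f

  Isomorphic : Set (a ⊔ b ⊔ ℓ₁ ⊔ ℓ₂)
  Isomorphic = ∃ IsŁukasiewiczIsomorphism

module _ (B : ŁukasiewiczAlgebra₃ b ℓ) where
  private
    module B = ŁukasiewiczAlgebra₃ B
  open B

  record Subalgebra p : Set (b ⊔ ℓ ⊔ suc p) where
    field
      U       : Pred Carrier p
      respect : U Respects _≈_
      ∨-mem   : ∀ {x y} → x ∈ U → y ∈ U → (x ∨ y) ∈ U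
      ∧-mem   : ∀ {x y} → x ∈ U → y ∈ U → (x ∧ y) ∈ U
      ∼-mem   : ∀ {x} → x ∈ U → (∼ x) ∈ U
      ∇-mem   : ∀ {x} → x ∈ U → (∇ x) ∈ U
      ⊤-mem   : ⊤ ∈ U

  subalgebra : Subalgebra p → ŁukasiewiczAlgebra₃ (b ⊔ p) ℓ
  subalgebra S = record
    { Carrier = ∃ U
    ; _≈_     = λ x y → proj₁ x ≈ proj₁ y
    ; _∨_     = λ (x , x∈U) (y , y∈U) → x ∨ y , ∨-mem x∈U y∈U
    ; _∧_     = λ (x , x∈U) (y , y∈U) → x ∧ y , ∧-mem x∈U y∈U
    ; ∼_      = λ (x , x∈U) → ∼ x , ∼-mem x∈U
    ; ∇_      = λ (x , x∈U) → ∇ x , ∇-mem x∈U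
    ; ⊤       = ⊤ , ⊤-mem
    ; isŁukasiewiczAlgebra₃ = record
      { isDeMorganAlgebra = record
        { isDistributiveLattice = record
          { isLattice = record
            { isEquivalence = record
              { refl = B.refl ; sym = B.sym ; trans = B.trans }
            ; ∨-comm     = λ x y → ∨-comm (proj₁ x) (proj₁ y)
            ; ∨-assoc    = λ x y z → ∨-assoc (proj₁ x) (proj₁ y) (proj₁ z)
            ; ∨-cong     = ∨-cong
            ; ∧-comm     = λ x y → ∧-comm (proj₁ x) (proj₁ y)
            ; ∧-assoc    = λ x y z → ∧-assoc (proj₁ x) (proj₁ y) (proj₁ z)
            ; ∧-cong     = ∧-cong
            ; absorptive = (λ x y → ∨-absorbs-∧ (proj₁ x) (proj₁ y))
                         , (λ x y → ∧-absorbs-∨ (proj₁ x) (proj₁ y))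
            }
          ; ∨-distrib-∧ = (λ x y z → ∨-distribˡ-∧ (proj₁ x) (proj₁ y) (proj₁ z))
                        , (λ x y z → ∨-distribʳ-∧ (proj₁ x) (proj₁ y) (proj₁ z))
          ; ∧-distrib-∨ = (λ x y z → ∧-distribˡ-∨ (proj₁ x) (proj₁ y) (proj₁ z))
                        , (λ x y z → ∧-distribʳ-∨ (proj₁ x) (proj₁ y) (proj₁ z))
          }
        ; ∧-identityʳ  = λ x → ∧-identityʳ (proj₁ x)
        ; ∼-cong       = ∼-cong
        ; ∼-involutive = λ x → ∼-involutive (proj₁ x)
        ; deMorgan     = λ x y → deMorgan (proj₁ x) (proj₁ y)
        }
      ; ∇-cong = ∇-cong
      ; ∼∨∇    = λ x → ∼∨∇ (proj₁ x)
      ; ∧∼     = λ x → ∧∼ (proj₁ x)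
      ; ∇-∧    = λ x y → ∇-∧ (proj₁ x) (proj₁ y)
      }
    }
    where open Subalgebra S

-- The set of objects is a setoid, so the relation has to respect its
-- equality; for an equivalence relation this is ≈⇒R.
record ApproximationSpace o e r : Set (suc (o ⊔ e ⊔ r)) where
  infix 4 _R_
  field
    objects       : Setoid o e
  open Setoid objects public using (_≈_) renaming (Carrier to Ob)
  field
    nonempty      : Ob
    _R_           : Rel Ob r
    isEquivalence : IsEquivalence _R_
    ≈⇒R           : _≈_ ⇒ _R_

  open IsEquivalence isEquivalence public
    renaming (refl to R-refl; sym to R-sym; trans to R-trans)

-- Excluded middle is needed for the rough sets to be closed under the
-- componentwise ∧ and ∨ and to satisfy the laws of negation.
module RoughSets (em : ∀ {ℓ} → ExcludedMiddle ℓ)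
                 (S : ApproximationSpace o e r) where
  open ApproximationSpace S
  private
    module ≈ = Setoid objects

    dne : ∀ {ℓ} {P : Set ℓ} → ¬ ¬ P → P
    dne = decidable-stable em

  record Subset : Set (suc (o ⊔ r) ⊔ e) where
    field
      pred    : Pred Ob (o ⊔ r)
      respect : pred Respects _≈_
  open Subset public

  infix  4 _≐ˢ_
  infixr 7 _∩ˢ_
  infixr 6 _∪ˢ_
  infix  8 ¬ˢ_

  _≐ˢ_ : Rel Subset (o ⊔ r)
  X ≐ˢ Y = pred X ≐ pred Y

  _∩ˢ_ _∪ˢ_ : Subset → Subset → Subset
  X ∩ˢ Y = record
    { pred    = pred X ∩ pred Y
    ; respect = λ x≈y (x∈X , x∈Y) → respect X x≈y x∈X , respect Y x≈y x∈Y
    }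
  X ∪ˢ Y = record
    { pred    = pred X ∪ pred Y
    ; respect = λ where
        x≈y (inj₁ x∈X) → inj₁ (respect X x≈y x∈X)
        x≈y (inj₂ x∈Y) → inj₂ (respect Y x≈y x∈Y)
    }

  ¬ˢ_ : Subset → Subset
  ¬ˢ X = record
    { pred    = ∁ (pred X)
    ; respect = λ x≈y x∉X y∈X → x∉X (respect X (≈.sym x≈y) y∈X)
    }

  full : Subset
  full = record { pred = λ _ → Unit ; respect = λ _ _ → tt }

  -- The equivalence classes are exactly the sets [ z ].
  [_] : Ob → Pred Ob r
  [ z ] x = z R x

  M : Subset → Subset
  M X = record
    { pred    = λ x → ∃ λ z → ([ z ] ≬ pred X) × x ∈ [ z ]
    ; respect = λ x≈y (z , z≬X , zRx) → z , z≬X , R-trans zRx (≈⇒R x≈y)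
    }

  L : Subset → Subset
  L X = ¬ˢ (M (¬ˢ X))

  ∈M : ∀ X {x y} → x R y → y ∈ pred X → x ∈ pred (M X)
  ∈M X xRy y∈X = _ , (_ , xRy , y∈X) , R-refl

  ∈M⁻ : ∀ X {x} → x ∈ pred (M X) → ∃ λ y → x R y × y ∈ pred X
  ∈M⁻ X (z , (y , zRy , y∈X) , zRx) = y , R-trans (R-sym zRx) zRy , y∈X

  ∈L : ∀ X {x} → (∀ {y} → x R y → y ∈ pred X) → x ∈ pred (L X)
  ∈L X h x∈M with ∈M⁻ (¬ˢ X) x∈M
  ... | y , xRy , y∉X = y∉X (h xRy)

  ∈L⁻ : ∀ X {x y} → x ∈ pred (L X) → x R y → y ∈ pred X
  ∈L⁻ X x∈L xRy = dne λ y∉X → x∈L (∈M (¬ˢ X) xRy y∉X)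

  M-R : ∀ X {x y} → x R y → y ∈ pred (M X) → x ∈ pred (M X)
  M-R X xRy y∈M with ∈M⁻ X y∈M
  ... | z , yRz , z∈X = ∈M X (R-trans xRy yRz) z∈X

  M-cong : ∀ X Y → X ≐ˢ Y → M X ≐ˢ M Y
  M-cong X Y (X⊆Y , Y⊆X) =
    (λ (z , (y , zRy , y∈X) , zRx) → z , (y , zRy , X⊆Y y∈X) , zRx) ,
    (λ (z , (y , zRy , y∈Y) , zRx) → z , (y , zRy , Y⊆X y∈Y) , zRx)

  ¬-cong : ∀ X Y → X ≐ˢ Y → ¬ˢ X ≐ˢ ¬ˢ Y
  ¬-cong X Y (X⊆Y , Y⊆X) = (_∘ Y⊆X) , (_∘ X⊆Y)

  ≐-sym : ∀ {X Y} → X ≐ˢ Y → Y ≐ˢ X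
  ≐-sym = swap

  ≐-trans : ∀ {X Y Z} → X ≐ˢ Y → Y ≐ˢ Z → X ≐ˢ Z
  ≐-trans (f , g) (h , k) = (λ x → h (f x)) , (λ x → g (k x))

  ¬¬ : ∀ X → ¬ˢ ¬ˢ X ≐ˢ X
  ¬¬ X = dne , λ x∈X x∉X → x∉X x∈X

  -- L¬X = ¬MX and M¬X = ¬LX
  L¬ : ∀ X → L (¬ˢ X) ≐ˢ ¬ˢ M X
  L¬ X = ¬-cong (M (¬ˢ ¬ˢ X)) (M X) (M-cong (¬ˢ ¬ˢ X) X (¬¬ X))

  M¬ : ∀ X → M (¬ˢ X) ≐ˢ ¬ˢ L X
  M¬ X = ≐-sym {¬ˢ L X} {M (¬ˢ X)} (¬¬ (M (¬ˢ X)))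

  -- In a class C meeting both X and Y but not X ∩ Y the generator of the
  -- meet consists of C ∩ X; in every other class it is C ∩ X ∩ Y.
  meetGen : Subset → Subset → Subset
  meetGen X Y = (X ∩ˢ Y) ∪ˢ (X ∩ˢ M Y ∩ˢ ¬ˢ M (X ∩ˢ Y))

  joinGen : Subset → Subset → Subset
  joinGen X Y = ¬ˢ meetGen (¬ˢ X) (¬ˢ Y)

  L-meetGen : ∀ X Y → (L X ∩ˢ L Y) ≐ˢ L (meetGen X Y)
  L-meetGen X Y = to , from
    where
    to : pred (L X ∩ˢ L Y) ⊆ pred (L (meetGen X Y))
    to (x∈LX , x∈LY) = ∈L (meetGen X Y) λ xRy →
      inj₁ (∈L⁻ X x∈LX xRy , ∈L⁻ Y x∈LY xRy)

    inX : ∀ {y} → y ∈ pred (meetGen X Y) → y ∈ pred X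
    inX (inj₁ (y∈X , _)) = y∈X
    inX (inj₂ (y∈X , _)) = y∈X

    inY : ∀ {x} → x ∈ pred (L (meetGen X Y)) →
          ∀ {y} → x R y → y ∈ pred (meetGen X Y) → y ∈ pred Y
    inY x∈L xRy (inj₁ (_ , y∈Y)) = y∈Y
    inY x∈L xRy (inj₂ (_ , y∈MY , y∉M)) with ∈M⁻ Y y∈MY
    ... | z , yRz , z∈Y =
      ⊥-elim (y∉M (∈M (X ∩ˢ Y) yRz
        (inX (∈L⁻ (meetGen X Y) x∈L (R-trans xRy yRz)) , z∈Y)))

    from : pred (L (meetGen X Y)) ⊆ pred (L X ∩ˢ L Y)
    from x∈L =
      ∈L X (λ xRy → inX (∈L⁻ (meetGen X Y) x∈L xRy)) ,
      ∈L Y (λ xRy → inY x∈L xRy (∈L⁻ (meetGen X Y) x∈L xRy))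

  M-meetGen : ∀ X Y → (M X ∩ˢ M Y) ≐ˢ M (meetGen X Y)
  M-meetGen X Y = to , from
    where
    to : pred (M X ∩ˢ M Y) ⊆ pred (M (meetGen X Y))
    to {x} (x∈MX , x∈MY) with em {P = x ∈ pred (M (X ∩ˢ Y))}
    ... | yes x∈M with ∈M⁻ (X ∩ˢ Y) x∈M
    ...   | y , xRy , y∈X∩Y = ∈M (meetGen X Y) xRy (inj₁ y∈X∩Y)
    to {x} (x∈MX , x∈MY) | no x∉M with ∈M⁻ X x∈MX
    ...   | y , xRy , y∈X = ∈M (meetGen X Y) xRy
              (inj₂ (y∈X , M-R Y (R-sym xRy) x∈MY , λ y∈M → x∉M (M-R (X ∩ˢ Y) xRy y∈M)))

    from : pred (M (meetGen X Y)) ⊆ pred (M X ∩ˢ M Y)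
    from x∈M with ∈M⁻ (meetGen X Y) x∈M
    ... | y , xRy , inj₁ (y∈X , y∈Y) = ∈M X xRy y∈X , ∈M Y xRy y∈Y
    ... | y , xRy , inj₂ (y∈X , y∈MY , _) = ∈M X xRy y∈X , M-R Y xRy y∈MY

  L-joinGen : ∀ X Y → (L X ∪ˢ L Y) ≐ˢ L (joinGen X Y)
  L-joinGen X Y = to , from
    where
    N = meetGen (¬ˢ X) (¬ˢ Y)

    to : pred (L X ∪ˢ L Y) ⊆ pred (L (joinGen X Y))
    to x∈ = proj₂ (L¬ N) λ x∈MN →
      let x∈M¬X , x∈M¬Y = proj₂ (M-meetGen (¬ˢ X) (¬ˢ Y)) x∈MN
      in [ (λ x∈LX → x∈LX x∈M¬X) , (λ x∈LY → x∈LY x∈M¬Y) ]′ x∈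

    from : pred (L (joinGen X Y)) ⊆ pred (L X ∪ˢ L Y)
    from x∈L = dne λ x∉ → proj₁ (L¬ N) x∈L
      (proj₁ (M-meetGen (¬ˢ X) (¬ˢ Y))
        (dne (x∉ ∘ inj₁) , dne (x∉ ∘ inj₂)))

  M-joinGen : ∀ X Y → (M X ∪ˢ M Y) ≐ˢ M (joinGen X Y)
  M-joinGen X Y = to , from
    where
    N = meetGen (¬ˢ X) (¬ˢ Y)

    to : pred (M X ∪ˢ M Y) ⊆ pred (M (joinGen X Y))
    to x∈ = proj₂ (M¬ N) λ x∈LN →
      let x∈L¬X , x∈L¬Y = proj₂ (L-meetGen (¬ˢ X) (¬ˢ Y)) x∈LN
      in [ proj₁ (L¬ X) x∈L¬X , proj₁ (L¬ Y) x∈L¬Y ]′ x∈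

    from : pred (M (joinGen X Y)) ⊆ pred (M X ∪ˢ M Y)
    from x∈M = dne λ x∉ → proj₁ (M¬ N) x∈M
      (proj₁ (L-meetGen (¬ˢ X) (¬ˢ Y))
        (proj₂ (L¬ X) (x∉ ∘ inj₁) , proj₂ (L¬ Y) (x∉ ∘ inj₂)))

  L-M : ∀ X → M X ≐ˢ L (M X)
  L-M X =
    (λ x∈M → ∈L (M X) λ xRy → M-R X (R-sym xRy) x∈M) ,
    (λ x∈L → ∈L⁻ (M X) x∈L R-refl)

  M-M : ∀ X → M X ≐ˢ M (M X)
  M-M X = (λ x∈M → ∈M (M X) R-refl x∈M) , from
    where
    from : pred (M (M X)) ⊆ pred (M X)
    from x∈MM with ∈M⁻ (M X) x∈MM
    ... | y , xRy , y∈M = M-R X xRy y∈M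

  record RoughSet : Set (suc (o ⊔ r) ⊔ e) where
    field
      lower upper : Subset
      generator   : Subset
      isLower     : lower ≐ˢ L generator
      isUpper     : upper ≐ˢ M generator
  open RoughSet public

  infix 4 _≈ʳ_

  -- Equality of the pairs (lower , upper); the generator is ignored.
  _≈ʳ_ : Rel RoughSet (o ⊔ r)
  ρ ≈ʳ σ = lower ρ ≐ˢ lower σ × upper ρ ≐ˢ upper σ

  private
    ∩-cong : ∀ {X X′ Y Y′} → X ≐ˢ X′ → Y ≐ˢ Y′ → (X ∩ˢ Y) ≐ˢ (X′ ∩ˢ Y′)
    ∩-cong (f , g) (h , k) = (λ (x , y) → f x , h y) , (λ (x , y) → g x , k y)

    ∪-cong : ∀ {X X′ Y Y′} → X ≐ˢ X′ → Y ≐ˢ Y′ → (X ∪ˢ Y) ≐ˢ (X′ ∪ˢ Y′)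
    ∪-cong (f , g) (h , k) =
      (λ { (inj₁ x) → inj₁ (f x) ; (inj₂ y) → inj₂ (h y) }) ,
      (λ { (inj₁ x) → inj₁ (g x) ; (inj₂ y) → inj₂ (k y) })

  infix  8 ∼ʳ_ ∇ʳ_
  infixr 7 _∧ʳ_
  infixr 6 _∨ʳ_

  _∧ʳ_ _∨ʳ_ : RoughSet → RoughSet → RoughSet
  ρ ∧ʳ σ = record
    { lower     = lower ρ ∩ˢ lower σ
    ; upper     = upper ρ ∩ˢ upper σ
    ; generator = meetGen X Y
    ; isLower   = ≐-trans {lower ρ ∩ˢ lower σ} {L X ∩ˢ L Y} {L (meetGen X Y)}
                    (∩-cong {lower ρ} {L X} {lower σ} {L Y} (isLower ρ) (isLower σ))
                    (L-meetGen X Y)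
    ; isUpper   = ≐-trans {upper ρ ∩ˢ upper σ} {M X ∩ˢ M Y} {M (meetGen X Y)}
                    (∩-cong {upper ρ} {M X} {upper σ} {M Y} (isUpper ρ) (isUpper σ))
                    (M-meetGen X Y)
    }
    where
    X = generator ρ
    Y = generator σ
  ρ ∨ʳ σ = record
    { lower     = lower ρ ∪ˢ lower σ
    ; upper     = upper ρ ∪ˢ upper σ
    ; generator = joinGen X Y
    ; isLower   = ≐-trans {lower ρ ∪ˢ lower σ} {L X ∪ˢ L Y} {L (joinGen X Y)}
                    (∪-cong {lower ρ} {L X} {lower σ} {L Y} (isLower ρ) (isLower σ))
                    (L-joinGen X Y)
    ; isUpper   = ≐-trans {upper ρ ∪ˢ upper σ} {M X ∪ˢ M Y} {M (joinGen X Y)}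
                    (∪-cong {upper ρ} {M X} {upper σ} {M Y} (isUpper ρ) (isUpper σ))
                    (M-joinGen X Y)
    }
    where
    X = generator ρ
    Y = generator σ

  ∼ʳ_ ∇ʳ_ : RoughSet → RoughSet
  ∼ʳ ρ = record
    { lower     = L (¬ˢ generator ρ)
    ; upper     = M (¬ˢ generator ρ)
    ; generator = ¬ˢ generator ρ
    ; isLower   = id , id
    ; isUpper   = id , id
    }
  ∇ʳ ρ = record
    { lower     = upper ρ
    ; upper     = upper ρ
    ; generator = M X
    ; isLower   = ≐-trans {upper ρ} {M X} {L (M X)} (isUpper ρ) (L-M X)
    ; isUpper   = ≐-trans {upper ρ} {M X} {M (M X)} (isUpper ρ) (M-M X)
    }
    where
    X = generator ρ

  ⊤ʳ : RoughSet
  ⊤ʳ = record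
    { lower     = full
    ; upper     = full
    ; generator = full
    ; isLower   = (λ _ → ∈L full λ _ → tt) , (λ _ → tt)
    ; isUpper   = (λ _ → ∈M full R-refl tt) , (λ _ → tt)
    }

  lower-∼ : ∀ ρ → lower (∼ʳ ρ) ≐ˢ ¬ˢ upper ρ
  lower-∼ ρ = ≐-trans {L (¬ˢ X)} {¬ˢ M X} {¬ˢ upper ρ} (L¬ X)
                (¬-cong (M X) (upper ρ) (≐-sym {upper ρ} {M X} (isUpper ρ)))
    where X = generator ρ

  upper-∼ : ∀ ρ → upper (∼ʳ ρ) ≐ˢ ¬ˢ lower ρ
  upper-∼ ρ = ≐-trans {M (¬ˢ X)} {¬ˢ L X} {¬ˢ lower ρ} (M¬ X)
                (¬-cong (L X) (lower ρ) (≐-sym {lower ρ} {L X} (isLower ρ)))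
    where X = generator ρ

  lower⊆upper : ∀ ρ → pred (lower ρ) ⊆ pred (upper ρ)
  lower⊆upper ρ x∈ = proj₂ (isUpper ρ)
    (∈M X R-refl (∈L⁻ X (proj₁ (isLower ρ) x∈) R-refl))
    where X = generator ρ

  ∼ʳ-cong : ∀ {ρ σ} → ρ ≈ʳ σ → ∼ʳ ρ ≈ʳ ∼ʳ σ
  ∼ʳ-cong {ρ} {σ} (l , u) =
    ((λ x → proj₂ (lower-∼ σ) (proj₁ (lower-∼ ρ) x ∘ proj₂ u)) ,
     (λ x → proj₂ (lower-∼ ρ) (proj₁ (lower-∼ σ) x ∘ proj₁ u))) ,
    ((λ x → proj₂ (upper-∼ σ) (proj₁ (upper-∼ ρ) x ∘ proj₂ l)) ,
     (λ x → proj₂ (upper-∼ ρ) (proj₁ (upper-∼ σ) x ∘ proj₁ l)))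

  ∼ʳ-involutive : ∀ ρ → ∼ʳ ∼ʳ ρ ≈ʳ ρ
  ∼ʳ-involutive ρ =
    ((λ x → dne λ x∉ → proj₁ (lower-∼ (∼ʳ ρ)) x (proj₂ (upper-∼ ρ) x∉)) ,
     (λ x → proj₂ (lower-∼ (∼ʳ ρ)) λ y → proj₁ (upper-∼ ρ) y x)) ,
    ((λ x → dne λ x∉ → proj₁ (upper-∼ (∼ʳ ρ)) x (proj₂ (lower-∼ ρ) x∉)) ,
     (λ x → proj₂ (upper-∼ (∼ʳ ρ)) λ y → proj₁ (lower-∼ ρ) y x))

  ¬∩ : ∀ {ℓ₁ ℓ₂} {P : Set ℓ₁} {Q : Set ℓ₂} → ¬ (P × Q) → ¬ P ⊎ ¬ Q
  ¬∩ {P = P} n with em {P = P}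
  ... | yes x = inj₂ λ y → n (x , y)
  ... | no ¬x = inj₁ ¬x

  ∼ʳ-deMorgan : ∀ ρ σ → ∼ʳ (ρ ∧ʳ σ) ≈ʳ ∼ʳ ρ ∨ʳ ∼ʳ σ
  ∼ʳ-deMorgan ρ σ =
    ((λ x → [ inj₁ ∘ proj₂ (lower-∼ ρ) , inj₂ ∘ proj₂ (lower-∼ σ) ]′
              (¬∩ (proj₁ (lower-∼ (ρ ∧ʳ σ)) x))) ,
     (λ x → proj₂ (lower-∼ (ρ ∧ʳ σ)) λ (y , z) →
              [ (λ w → proj₁ (lower-∼ ρ) w y) , (λ w → proj₁ (lower-∼ σ) w z) ]′ x)) ,
    ((λ x → [ inj₁ ∘ proj₂ (upper-∼ ρ) , inj₂ ∘ proj₂ (upper-∼ σ) ]′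
              (¬∩ (proj₁ (upper-∼ (ρ ∧ʳ σ)) x))) ,
     (λ x → proj₂ (upper-∼ (ρ ∧ʳ σ)) λ (y , z) →
              [ (λ w → proj₁ (upper-∼ ρ) w y) , (λ w → proj₁ (upper-∼ σ) w z) ]′ x))

  ∼∨∇ʳ : ∀ ρ → ∼ʳ ρ ∨ʳ ∇ʳ ρ ≈ʳ ⊤ʳ
  ∼∨∇ʳ ρ =
    ((λ _ → tt) , (λ {x} _ → l x)) , ((λ _ → tt) , (λ {x} _ → u x))
    where
    l : Universal (pred (lower (∼ʳ ρ ∨ʳ ∇ʳ ρ)))
    l x with em {P = x ∈ pred (upper ρ)}
    ... | yes x∈ = inj₂ x∈
    ... | no  x∉ = inj₁ (proj₂ (lower-∼ ρ) x∉)
    u : Universal (pred (upper (∼ʳ ρ ∨ʳ ∇ʳ ρ)))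
    u x with em {P = x ∈ pred (upper ρ)}
    ... | yes x∈ = inj₂ x∈
    ... | no  x∉ = inj₁ (proj₂ (upper-∼ ρ) λ x∈ → x∉ (lower⊆upper ρ x∈))

  ∧∼ʳ : ∀ ρ → ρ ∧ʳ ∼ʳ ρ ≈ʳ ∼ʳ ρ ∧ʳ ∇ʳ ρ
  ∧∼ʳ ρ =
    ((λ (x , y) → ⊥-elim (proj₁ (lower-∼ ρ) y (lower⊆upper ρ x))) ,
     (λ (y , x) → ⊥-elim (proj₁ (lower-∼ ρ) y x))) ,
    (swap , swap)

  ∩∪ : ∀ {P Q T : Set (o ⊔ r)} → P × (Q ⊎ T) → (P × Q) ⊎ (P × T)
  ∩∪ (p , inj₁ q) = inj₁ (p , q)
  ∩∪ (p , inj₂ t) = inj₂ (p , t)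

  ∩∪⁻ : ∀ {P Q T : Set (o ⊔ r)} → (P × Q) ⊎ (P × T) → P × (Q ⊎ T)
  ∩∪⁻ (inj₁ (p , q)) = p , inj₁ q
  ∩∪⁻ (inj₂ (p , t)) = p , inj₂ t

  ∪∩ : ∀ {P Q T : Set (o ⊔ r)} → P ⊎ (Q × T) → (P ⊎ Q) × (P ⊎ T)
  ∪∩ (inj₁ p)       = inj₁ p , inj₁ p
  ∪∩ (inj₂ (q , t)) = inj₂ q , inj₂ t

  ∪∩⁻ : ∀ {P Q T : Set (o ⊔ r)} → (P ⊎ Q) × (P ⊎ T) → P ⊎ (Q × T)
  ∪∩⁻ (inj₁ p , _)      = inj₁ p
  ∪∩⁻ (inj₂ _ , inj₁ p) = inj₁ p
  ∪∩⁻ (inj₂ q , inj₂ t) = inj₂ (q , t)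

  comm⊎ : ∀ {P Q : Set (o ⊔ r)} → P ⊎ Q → Q ⊎ P
  comm⊎ = [ inj₂ , inj₁ ]′

  map⊎ : ∀ {P Q P′ Q′ : Set (o ⊔ r)} → (P → P′) → (Q → Q′) → P ⊎ Q → P′ ⊎ Q′
  map⊎ f g = [ inj₁ ∘ f , inj₂ ∘ g ]′

  assoc⊎ : ∀ {P Q T : Set (o ⊔ r)} → (P ⊎ Q) ⊎ T → P ⊎ (Q ⊎ T)
  assoc⊎ = [ [ inj₁ , inj₂ ∘ inj₁ ]′ , inj₂ ∘ inj₂ ]′

  assoc⊎⁻ : ∀ {P Q T : Set (o ⊔ r)} → P ⊎ (Q ⊎ T) → (P ⊎ Q) ⊎ T
  assoc⊎⁻ = [ inj₁ ∘ inj₁ , [ inj₁ ∘ inj₂ , inj₂ ]′ ]′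

  assoc× : ∀ {P Q T : Set (o ⊔ r)} → (P × Q) × T → P × (Q × T)
  assoc× ((p , q) , t) = p , q , t

  assoc×⁻ : ∀ {P Q T : Set (o ⊔ r)} → P × (Q × T) → (P × Q) × T
  assoc×⁻ (p , q , t) = (p , q) , t

  both : ∀ {P : Set (o ⊔ r)} → P → P × P
  both x = x , x

  roughSetAlgebra : ŁukasiewiczAlgebra₃ (suc (o ⊔ r) ⊔ e) (o ⊔ r)
  roughSetAlgebra = record
    { Carrier = RoughSet
    ; _≈_     = _≈ʳ_
    ; _∨_     = _∨ʳ_
    ; _∧_     = _∧ʳ_
    ; ∼_      = ∼ʳ_
    ; ∇_      = ∇ʳ_
    ; ⊤       = ⊤ʳ
    ; isŁukasiewiczAlgebra₃ = record
      { isDeMorganAlgebra = record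
        { isDistributiveLattice = record
          { isLattice = record
            { isEquivalence = record
              { refl  = (id , id) , (id , id)
              ; sym   = λ (l , u) → swap l , swap u
              ; trans = λ ((f , g) , (h , k)) ((f′ , g′) , (h′ , k′)) →
                  ((λ x → f′ (f x)) , (λ x → g (g′ x))) ,
                  ((λ x → h′ (h x)) , (λ x → k (k′ x)))
              }
            ; ∨-comm     = λ _ _ → (comm⊎ , comm⊎) , (comm⊎ , comm⊎)
            ; ∨-assoc    = λ _ _ _ → (assoc⊎ , assoc⊎⁻) , (assoc⊎ , assoc⊎⁻)
            ; ∨-cong     = λ ((f , g) , (h , k)) ((f′ , g′) , (h′ , k′)) →
                (map⊎ f f′ , map⊎ g g′) , (map⊎ h h′ , map⊎ k k′)
            ; ∧-comm     = λ _ _ → (swap , swap) , (swap , swap)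
            ; ∧-assoc    = λ _ _ _ → (assoc× , assoc×⁻) , (assoc× , assoc×⁻)
            ; ∧-cong     = λ ((f , g) , (h , k)) ((f′ , g′) , (h′ , k′)) →
                ((λ (x , y) → f x , f′ y) , (λ (x , y) → g x , g′ y)) ,
                ((λ (x , y) → h x , h′ y) , (λ (x , y) → k x , k′ y))
            ; absorptive =
                (λ _ _ → ([ id , proj₁ ]′ , inj₁) , ([ id , proj₁ ]′ , inj₁)) ,
                (λ _ _ → (proj₁ , λ x → x , inj₁ x) , (proj₁ , λ x → x , inj₁ x))
            }
          ; ∨-distrib-∧ =
              (λ _ _ _ → (∪∩ , ∪∩⁻) , (∪∩ , ∪∩⁻)) ,
              (λ _ _ _ →
                ((λ x → let y , z = ∪∩ (comm⊎ x) in comm⊎ y , comm⊎ z) ,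
                 (λ (y , z) → comm⊎ (∪∩⁻ (comm⊎ y , comm⊎ z)))) ,
                ((λ x → let y , z = ∪∩ (comm⊎ x) in comm⊎ y , comm⊎ z) ,
                 (λ (y , z) → comm⊎ (∪∩⁻ (comm⊎ y , comm⊎ z)))))
          ; ∧-distrib-∨ =
              (λ _ _ _ → (∩∪ , ∩∪⁻) , (∩∪ , ∩∪⁻)) ,
              (λ _ _ _ →
                ((λ x → map⊎ swap swap (∩∪ (swap x))) ,
                 (λ x → swap (∩∪⁻ (map⊎ swap swap x)))) ,
                ((λ x → map⊎ swap swap (∩∪ (swap x))) ,
                 (λ x → swap (∩∪⁻ (map⊎ swap swap x)))))
          }
        ; ∧-identityʳ  = λ _ → (proj₁ , λ x → x , tt) , (proj₁ , λ x → x , tt)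
        ; ∼-cong       = λ {ρ} {σ} → ∼ʳ-cong {ρ} {σ}
        ; ∼-involutive = ∼ʳ-involutive
        ; deMorgan     = ∼ʳ-deMorgan
        }
      ; ∇-cong = λ (_ , u) → u , u
      ; ∼∨∇    = ∼∨∇ʳ
      ; ∧∼     = ∧∼ʳ
      ; ∇-∧    = λ _ _ → (id , id) , (id , id)
      }
    }

open RoughSets public using (roughSetAlgebra)

module _ (A : ŁukasiewiczAlgebra₃ c ℓ) where
  open ŁukasiewiczAlgebra₃ A

  record IsPrimeFilter (F : Pred Carrier (c ⊔ ℓ)) : Set (c ⊔ ℓ) where
    field
      inhabited    : Satisfiable F
      upwardClosed : ∀ {x y} → x ≤ y → x ∈ F → y ∈ F
      ∧-closed     : ∀ {x y} → x ∈ F → y ∈ F → (x ∧ y) ∈ F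
      proper       : ¬ Universal F
      prime        : ∀ {x y} → (x ∨ y) ∈ F → x ∈ F ⊎ y ∈ F

  record PrimeFilter : Set (suc (c ⊔ ℓ)) where
    field
      filter        : Pred Carrier (c ⊔ ℓ)
      isPrimeFilter : IsPrimeFilter filter
    open IsPrimeFilter isPrimeFilter public

  open PrimeFilter

  primeFilters : Setoid (suc (c ⊔ ℓ)) (c ⊔ ℓ)
  primeFilters = record
    { Carrier       = PrimeFilter
    ; _≈_           = λ P Q → filter P ≐ filter Q
    ; isEquivalence = record
      { refl  = id , id
      ; sym   = swap
      ; trans = λ (f , g) (h , k) → (λ x → h (f x)) , (λ x → g (k x))
      }
    }

  Comparable : Rel PrimeFilter (c ⊔ ℓ)
  Comparable P Q = filter P ⊆ filter Q ⊎ filter Q ⊆ filter P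

module PrimeFilterProperties (A : ŁukasiewiczAlgebra₃ c ℓ) where
  open ŁukasiewiczAlgebra₃ A
  open PrimeFilter

  private
    PF = PrimeFilter A
    _~_ = Comparable A

    module O = OrderLattice.Lattice
      (DistributiveLatticeProperties.∨-∧-orderTheoreticLattice distributiveLattice)

  x≤⊤ : ∀ {x} → x ≤ ⊤
  x≤⊤ = sym (∧-identityʳ _)

  ∼-anti : ∀ {x y} → x ≤ y → ∼ y ≤ ∼ x
  ∼-anti {x} {y} x≤y = O.trans (O.y≤x∨y (∼ x) (∼ y))
    (O.reflexive (trans (sym (deMorgan x y)) (∼-cong (sym x≤y))))

  ∇-mono : ∀ {x y} → x ≤ y → ∇ x ≤ ∇ y
  ∇-mono {x} {y} x≤y = trans (∇-cong x≤y) (∇-∧ x y)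

  ∼⊤≤ : ∀ {x} → ∼ ⊤ ≤ x
  ∼⊤≤ {x} = O.trans (∼-anti x≤⊤) (O.reflexive (∼-involutive x))

  ≤∇ : ∀ {x} → x ≤ ∇ x
  ≤∇ {x} = O.trans
    (O.reflexive (trans (sym (∧-identityʳ x))
      (trans (∧-congˡ (sym (∼∨∇ x))) (∧-distribˡ-∨ x (∼ x) (∇ x)))))
    (O.∨-least (O.trans (O.reflexive (∧∼ x)) (O.x∧y≤y _ _)) (O.x∧y≤y _ _))

  ∇∼⊤≤∼⊤ : ∇ ∼ ⊤ ≤ ∼ ⊤
  ∇∼⊤≤∼⊤ = O.trans
    (O.∧-greatest (O.trans x≤⊤ (O.reflexive (sym (∼-involutive ⊤)))) O.refl)
    (O.trans (O.reflexive (sym (∧∼ (∼ ⊤)))) (O.x∧y≤x _ _))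

  ∧∼∇≤∼⊤ : ∀ {x} → x ∧ ∼ ∇ x ≤ ∼ ⊤
  ∧∼∇≤∼⊤ {x} = O.reflexive (trans (sym (∼-involutive _))
    (∼-cong (trans (deMorgan x (∼ ∇ x))
      (trans (∨-congˡ (∼-involutive (∇ x))) (∼∨∇ x)))))

  ∇∧∼∇≤∼⊤ : ∀ {x} → ∇ x ∧ ∼ ∇ x ≤ ∼ ⊤
  ∇∧∼∇≤∼⊤ {x} = O.trans
    (O.∧-greatest (O.x∧y≤x _ _) (O.trans (O.x∧y≤y _ _) ≤∇))
    (O.trans (O.reflexive (sym (∇-∧ x (∼ ∇ x))))
      (O.trans (∇-mono ∧∼∇≤∼⊤) ∇∼⊤≤∼⊤))

  module _ (P : PF) where
    ⊤∈ : ⊤ ∈ filter P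
    ⊤∈ = upwardClosed P x≤⊤ (proj₂ (inhabited P))

    resp : ∀ {x y} → x ≈ y → x ∈ filter P → y ∈ filter P
    resp x≈y = upwardClosed P (O.reflexive x≈y)

    ∼⊤∉ : ∼ ⊤ ∉ filter P
    ∼⊤∉ ∼⊤∈ = proper P λ x → upwardClosed P ∼⊤≤ ∼⊤∈

    ∇-or : ∀ x → ∼ ∇ x ∈ filter P ⊎ ∇ x ∈ filter P
    ∇-or x = prime P (upwardClosed P
      (O.trans (O.reflexive (sym (∼-involutive ⊤)))
        (O.trans (∼-anti ∇∧∼∇≤∼⊤)
          (O.reflexive (trans (deMorgan (∇ x) (∼ ∇ x)) (∨-congˡ (∼-involutive (∇ x)))))))
      ⊤∈)

    ∼∇ : ∀ {x} → ∼ x ∈ filter P → ∇ x ∈ filter P → x ∈ filter P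
    ∼∇ {x} ∼x∈ ∇x∈ = upwardClosed P (O.x∧y≤x _ _)
      (resp (sym (∧∼ x)) (∧-closed P ∼x∈ ∇x∈))

    ∇∼ : ∀ {x} → x ∉ filter P → ∇ ∼ x ∈ filter P
    ∇∼ {x} x∉ = [ (λ h → ⊥-elim (x∉ (resp (∼-involutive x) h))) , id ]′
      (prime P (resp (sym (∼∨∇ (∼ x))) ⊤∈))

    kleene : ∀ {x y} → x ∈ filter P → ∼ x ∈ filter P →
             y ∉ filter P → ∼ y ∉ filter P → ∇ ∼ x ∈ filter P → ∇ y ∈ filter P →
             ∀ {k} {X : Set k} → X
    kleene {x} {y} x∈ ∼x∈ y∉ ∼y∉ ∇∼x∈ ∇y∈ =
      ⊥-elim ([ y∉ , ∼y∉ ]′ (prime P (upwardClosed P (O.x∧y≤x _ _) u∈)))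
      where
      u = (y ∨ ∼ y) ∧ ∼ (x ∧ ∼ x)
      ∼u∈ : ∼ u ∈ filter P
      ∼u∈ = upwardClosed P (∼-anti (O.x∧y≤y _ _))
        (resp (sym (∼-involutive _)) (∧-closed P x∈ ∼x∈))
      ∇u∈ : ∇ u ∈ filter P
      ∇u∈ = resp (sym (∇-∧ _ _)) (∧-closed P
        (upwardClosed P (∇-mono (O.x≤x∨y _ _)) ∇y∈)
        (upwardClosed P (∇-mono (∼-anti (O.x∧y≤x _ _))) ∇∼x∈))
      u∈ : u ∈ filter P
      u∈ = ∼∇ ∼u∈ ∇u∈

  ∇-transfer : ∀ P Q → P ~ Q → ∀ {x} → ∇ x ∈ filter P → ∇ x ∈ filter Q
  ∇-transfer P Q (inj₁ P⊆Q) ∇x∈P = P⊆Q ∇x∈P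
  ∇-transfer P Q (inj₂ Q⊆P) {x} ∇x∈P =
    [ (λ ∼∇x∈Q → ⊥-elim (∼⊤∉ P (upwardClosed P ∇∧∼∇≤∼⊤ (∧-closed P ∇x∈P (Q⊆P ∼∇x∈Q)))))
    , id ]′ (∇-or Q x)

  Comparable-sym : ∀ P Q → P ~ Q → Q ~ P
  Comparable-sym P Q = [ inj₂ , inj₁ ]′

  module _ (em : ∀ {ℓ} → ExcludedMiddle ℓ) where
    private
      ⊈ : ∀ (P Q : PF) → ¬ (filter P ⊆ filter Q) →
          ∃ λ (x : Carrier) → x ∈ filter P × x ∉ filter Q
      ⊈ P Q P⊈Q = decidable-stable em λ ∄ → P⊈Q λ x∈P →
        decidable-stable em λ x∉Q → ∄ (_ , x∈P , x∉Q)

    Comparable-trans : Transitive _~_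
    Comparable-trans {P} {Q} {S} PQ QS
      with em {P = filter P ⊆ filter S} | em {P = filter S ⊆ filter P}
    ... | yes P⊆S | _       = inj₁ P⊆S
    ... | no  _   | yes S⊆P = inj₂ S⊆P
    ... | no P⊈S  | no S⊈P with ⊈ P S P⊈S | ⊈ S P S⊈P
    ...   | x , x∈P , x∉S | y , y∈S , y∉P =
      kleene P x∈P ∼x∈P y∉P (λ ∼y∈P → y∉P (∼∇ P ∼y∈P ∇y∈P)) ∇∼x∈P ∇y∈P
      where
      S→P : ∀ {z} → ∇ z ∈ filter S → ∇ z ∈ filter P
      S→P h = ∇-transfer Q P (Comparable-sym P Q PQ)
                (∇-transfer S Q (Comparable-sym Q S QS) h)
      ∇∼x∈P : ∇ ∼ x ∈ filter P
      ∇∼x∈P = S→P (∇∼ S x∉S)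
      ∼x∈P : ∼ x ∈ filter P
      ∼x∈P = ∼∇ P (resp P (sym (∼-involutive x)) x∈P) ∇∼x∈P
      ∇y∈P : ∇ y ∈ filter P
      ∇y∈P = S→P (upwardClosed S ≤∇ y∈S)

module _ (A : ŁukasiewiczAlgebra₃ c ℓ) (em : ∀ {ℓ} → ExcludedMiddle ℓ) where
  open PrimeFilterProperties A

  -- The set of objects has to be nonempty, which P₀ witnesses (the
  -- one-element algebra has no prime filters).
  primeFilterSpace : PrimeFilter A → ApproximationSpace (suc (c ⊔ ℓ)) (c ⊔ ℓ) (c ⊔ ℓ)
  primeFilterSpace P₀ = record
    { objects       = primeFilters A
    ; nonempty      = P₀
    ; _R_           = Comparable A
    ; isEquivalence = record
      { refl  = inj₁ id
      ; sym   = λ {P} {Q} → Comparable-sym P Q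
      ; trans = λ {P} {Q} {S} → Comparable-trans em {P} {Q} {S}
      }
    ; ≈⇒R           = λ P≐Q → inj₁ (proj₁ P≐Q)
    }

{-# OPTIONS --safe #-}
module Submission where

open import Defs
open import Axiom.ExcludedMiddle using (ExcludedMiddle)
open import Axiom.Extensionality.Propositional using (Extensionality)
open import Algebra.Lattice.Morphism.Structures using (IsLatticeHomomorphism)
import Algebra.Lattice.Properties.DistributiveLattice as DistributiveLatticeProperties
open import Data.Bool.Base using (Bool; true; false; T)
open import Data.Empty using (⊥-elim)
open import Data.List.Base using (List; []; _∷_; _++_; foldr)
open import Data.List.Relation.Unary.All as All using (All; []; _∷_)
open import Data.List.Relation.Unary.All.Properties using (++⁺)
open import Data.Product using (∃; _×_; _,_; proj₁; proj₂)
open import Data.Sum using (_⊎_; inj₁; inj₂; [_,_]′)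
import Data.Sum as Sum
open import Data.Unit.Polymorphic using (tt)
open import Function using (_∘_; id)
open import Function.Definitions using (Injective)
open import Level using (Level; Lift; lift; lower; _⊔_; suc)
import Relation.Binary.Lattice as OrderLattice
open import Relation.Binary.PropositionalEquality using (_≡_; refl)
open import Relation.Nullary using (¬_; Dec; yes; no)
open import Relation.Nullary.Decidable using (decidable-stable; ⌊_⌋; toWitness; fromWitness)
open import Relation.Unary using (Pred)

-- An element x of A is sent to the rough set generated by {P | x ∈ P}; its
-- lower and upper approximations turn out to be {P | ∇∼x ∉ P} and
-- {P | ∇x ∈ P}.  This holds because the involution P ↦ {x | ∼x ∉ P} maps P
-- to a prime filter comparable with P.  For injectivity, take a prime filter P
-- with x ∈ P and y ∉ P.  If the rough sets of x and y agreed, then ∇y ∈ P and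
-- ∇∼x ∈ P, hence x, ∼x ∈ P and y, ∼y ∉ P, against Kleene's law x ∧ ∼x ≤ y ∨ ∼y.
--
-- Excluded middle for arbitrary types acts as a choice operator, because it
-- decides Σ-types with a witness.  For the prime filter theorem the choices
-- have to respect extensional equality of subsets, so subsets are Bool-valued
-- and function extensionality makes extensional equality propositional.

private
  variable
    a b c ℓ p ℓ₁ ℓ₂ : Level

-- Maximal finitely consistent subsets, by a tower construction in place of Zorn's lemma.

module Tukey (em : ∀ {ℓ} → ExcludedMiddle ℓ) (funext : ∀ {a b} → Extensionality a b)
             {A : Set a} (Consistent : Pred (List A) p) where

  infix 4 _∈_ _∉_ _⊆_

  Subset : Set a
  Subset = A → Bool

  _∈_ _∉_ : A → Subset → Set
  x ∈ S = T (S x)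
  x ∉ S = ¬ x ∈ S

  _⊆_ : Subset → Subset → Set a
  S ⊆ S′ = ∀ {x} → x ∈ S → x ∈ S′

  T-antisym : ∀ {x y} → (T x → T y) → (T y → T x) → x ≡ y
  T-antisym {true}  {true}  _ _ = refl
  T-antisym {true}  {false} f _ = ⊥-elim (f _)
  T-antisym {false} {true}  _ g = ⊥-elim (g _)
  T-antisym {false} {false} _ _ = refl

  ⊆-antisym : ∀ {S S′} → S ⊆ S′ → S′ ⊆ S → S ≡ S′
  ⊆-antisym f g = funext λ x → T-antisym f g

  insert : A → Subset → Subset
  insert x S y = ⌊ em {P = y ≡ x ⊎ y ∈ S} ⌋

  ⋃ : (Subset → Bool) → Subset
  ⋃ C x = ⌊ em {P = ∃ λ S → T (C S) × x ∈ S} ⌋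

  FinitelyConsistent : Pred Subset (a ⊔ p)
  FinitelyConsistent S = ∀ xs → All (_∈ S) xs → Consistent xs

  Extension : Subset → Set (a ⊔ p)
  Extension S = ∃ λ x → x ∉ S × FinitelyConsistent (insert x S)

  -- With the decision as an argument, `step S` unfolds to an application of `em`, which later
  -- proofs abstract by `with em`.
  extend : ∀ S → Dec (Extension S) → Subset
  extend S (yes (x , _)) = insert x S
  extend S (no _)        = S

  step : Subset → Subset
  step S = extend S em

  ⊆-step : ∀ S → S ⊆ step S
  ⊆-step S with em {P = Extension S}
  ... | yes _ = fromWitness ∘ inj₂
  ... | no  _ = id

  -- At most one element is added, so nothing lies strictly between `S` and `step S`.
  step-covers : ∀ S S′ → S ⊆ S′ → S′ ⊆ step S → S ≡ S′ ⊎ step S ⊆ S′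
  step-covers S S′ S⊆S′ S′⊆ with em {P = Extension S}
  ... | no  _ = inj₁ (⊆-antisym S⊆S′ S′⊆)
  ... | yes (x , _) with em {P = x ∈ S′}
  ...   | yes x∈S′ = inj₂ λ y∈ → [ (λ { refl → x∈S′ }) , S⊆S′ ]′ (toWitness y∈)
  ...   | no  x∉S′ = inj₁ (⊆-antisym S⊆S′ λ y∈S′ →
            [ (λ { refl → ⊥-elim (x∉S′ y∈S′) }) , id ]′ (toWitness (S′⊆ y∈S′)))

  -- The empty union supplies the starting set. `C` is Bool-valued, so quantifying over it does not
  -- raise the universe level.
  data Tower : Subset → Set a where
    next  : ∀ {S} → Tower S → Tower (step S)
    union : ∀ C → (∀ {S} → T (C S) → Tower S) → Tower (⋃ C)

  ⋃-compare : ∀ C S′ → (∀ {S} → T (C S) → S ⊆ S′ ⊎ S′ ⊆ S) → ⋃ C ⊆ S′ ⊎ S′ ⊆ ⋃ C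
  ⋃-compare C S′ cmp with em {P = ∃ λ S → T (C S) × S′ ⊆ S}
  ... | yes (S , S∈C , S′⊆S) = inj₂ λ x∈ → fromWitness (S , S∈C , S′⊆S x∈)
  ... | no  ∄ = inj₁ below
    where
    below : ⋃ C ⊆ S′
    below x∈ with toWitness x∈
    ... | S , S∈C , x∈S with cmp S∈C
    ...   | inj₁ S⊆S′ = S⊆S′ x∈S
    ...   | inj₂ S′⊆S = ⊥-elim (∄ (S , S∈C , S′⊆S))

  -- Simultaneous induction on both derivations: each recursive call shrinks at least one of them
  -- and enlarges neither.
  Tower-total : ∀ {S S′} → Tower S → Tower S′ → S ⊆ S′ ⊎ S′ ⊆ S
  Tower-total (union C C⊆T) t′ = ⋃-compare C _ λ S∈C → Tower-total (C⊆T S∈C) t′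
  Tower-total (next t) (union C C⊆T) =
    Sum.swap (⋃-compare C _ λ S∈C → Sum.swap (Tower-total (next t) (C⊆T S∈C)))
  Tower-total (next {S} t) (next {S′} t′)
    with Tower-total t (next t′) | Tower-total (next t) t′ | Tower-total t t′
  ... | inj₂ S′₊⊆S | _ | _ = inj₂ (⊆-step S ∘ S′₊⊆S)
  ... | _ | inj₁ S₊⊆S′ | _ = inj₁ (⊆-step S′ ∘ S₊⊆S′)
  -- Now `S ⊆ S′ ⊆ step S`, so `step-covers` applies; the last clause is the mirror image.
  ... | inj₁ S⊆S′₊ | inj₂ S′⊆S₊ | inj₁ S⊆S′ with step-covers S S′ S⊆S′ S′⊆S₊
  ...   | inj₁ refl  = inj₁ id
  ...   | inj₂ S₊⊆S′ = inj₁ (⊆-step S′ ∘ S₊⊆S′)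
  Tower-total (next {S} t) (next {S′} t′)
      | inj₁ S⊆S′₊ | inj₂ S′⊆S₊ | inj₂ S′⊆S with step-covers S′ S S′⊆S S⊆S′₊
  ...   | inj₁ refl  = inj₁ id
  ...   | inj₂ S′₊⊆S = inj₂ (⊆-step S ∘ S′₊⊆S)

  module _ (C : Subset → Bool) (C⊆T : ∀ {S} → T (C S) → Tower S) where

    -- `C` is a chain by `Tower-total`, so of finitely many members the largest contains the whole
    -- list; `S₀` serves the empty list.
    chain-bound : ∀ {S₀ xs} → T (C S₀) → All (_∈ ⋃ C) xs → ∃ λ S → T (C S) × All (_∈ S) xs
    chain-bound S₀∈C []         = _ , S₀∈C , []
    chain-bound S₀∈C (x∈ ∷ xs∈) with toWitness x∈ | chain-bound S₀∈C xs∈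
    ... | S , S∈C , x∈S | S′ , S′∈C , xs∈S′ with Tower-total (C⊆T S∈C) (C⊆T S′∈C)
    ...   | inj₁ S⊆S′ = S′ , S′∈C , S⊆S′ x∈S ∷ xs∈S′
    ...   | inj₂ S′⊆S = S , S∈C , x∈S ∷ All.map S′⊆S xs∈S′

  step-consistent : ∀ S → FinitelyConsistent S → FinitelyConsistent (step S)
  step-consistent S con with em {P = Extension S}
  ... | yes (_ , _ , con′) = con′
  ... | no  _              = con

  Tower-consistent : Consistent [] → ∀ {S} → Tower S → FinitelyConsistent S
  Tower-consistent con[] (next {S} t) = step-consistent S (Tower-consistent con[] t)
  -- `C` may be empty, so there need not be a member to inherit consistency from.
  Tower-consistent con[] (union C C⊆T) []         _            = con[]
  Tower-consistent con[] (union C C⊆T) xs@(_ ∷ _) xs∈@(x∈ ∷ _)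
    with chain-bound C C⊆T (proj₁ (proj₂ (toWitness x∈))) xs∈
  ... | S , S∈C , xs∈S = Tower-consistent con[] (C⊆T S∈C) xs xs∈S

  top : Subset
  top = ⋃ λ S → ⌊ em {P = Tower S} ⌋

  Tower-top : Tower top
  Tower-top = union _ toWitness

  step-top : step top ⊆ top
  step-top x∈ = fromWitness (step top , fromWitness (next Tower-top) , x∈)

  -- If any one-element extension were consistent, `step top` would add some `y`, perhaps other than
  -- `x`; but `step top` is in the tower and hence inside `top`.
  top-maximal : ∀ {x} → x ∉ top → ¬ FinitelyConsistent (insert x top)
  top-maximal {x} x∉ con with em {P = Extension top} | step-top
  ... | yes (y , y∉ , _) | ⊆top = y∉ (⊆top (fromWitness (inj₁ refl)))
  ... | no  ∄            | _    = ∄ (x , x∉ , con)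

  inconsistent-with-top : ∀ {x} → x ∉ top →
    ∃ λ xs → All (λ y → y ≡ x ⊎ y ∈ top) xs × ¬ Consistent xs
  inconsistent-with-top x∉ = decidable-stable em λ ∄ → top-maximal x∉ λ xs xs∈ →
    decidable-stable em λ ¬con → ∄ (xs , All.map toWitness xs∈ , ¬con)

-- The prime filter separation theorem.

module PrimeFilterTheorem (em : ∀ {ℓ} → ExcludedMiddle ℓ)
                          (funext : ∀ {a b} → Extensionality a b)
                          (A : ŁukasiewiczAlgebra₃ c ℓ) where
  open ŁukasiewiczAlgebra₃ A hiding (refl)
  private
    module O = OrderLattice.Lattice
      (DistributiveLatticeProperties.∨-∧-orderTheoreticLattice distributiveLattice)

  module _ {x y : Carrier} (x≰y : ¬ x ≤ y) where

    -- Starting from `x` instead of `⊤` puts `x` into the filter from the outset and makes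
    -- consistency of the empty list the hypothesis `x≰y`.
    ⋀ : List Carrier → Carrier
    ⋀ = foldr _∧_ x

    open Tukey em funext (λ zs → ¬ ⋀ zs ≤ y)
      using (_∈_; top; Tower-top; Tower-consistent; inconsistent-with-top)

    ⋀-lower : ∀ zs → ⋀ zs ≤ x
    ⋀-lower []       = O.refl
    ⋀-lower (z ∷ zs) = O.trans (O.x∧y≤y _ _) (⋀-lower zs)

    ⋀-++ : ∀ zs zs′ → ⋀ (zs ++ zs′) ≤ ⋀ zs × ⋀ (zs ++ zs′) ≤ ⋀ zs′
    ⋀-++ []       zs′ = ⋀-lower zs′ , O.refl
    ⋀-++ (z ∷ zs) zs′ with ⋀-++ zs zs′
    ... | ≤zs , ≤zs′ = O.∧-greatest (O.x∧y≤x _ _) (O.trans (O.x∧y≤y _ _) ≤zs)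
                     , O.trans (O.x∧y≤y _ _) ≤zs′

    -- The filter generated by `x` and `top`: closure under `≤` and `∧` is built in, and maximality
    -- of `top` is left for primeness.
    Generated : Pred Carrier (c ⊔ ℓ)
    Generated u = ∃ λ zs → All (_∈ top) zs × ⋀ zs ≤ u

    Generated-↑ : ∀ {u v} → u ≤ v → Generated u → Generated v
    Generated-↑ u≤v (zs , zs∈ , ≤u) = zs , zs∈ , O.trans ≤u u≤v

    Generated-∧ : ∀ {u v} → Generated u → Generated v → Generated (u ∧ v)
    Generated-∧ (zs , zs∈ , ≤u) (zs′ , zs′∈ , ≤v) with ⋀-++ zs zs′
    ... | ≤zs , ≤zs′ = zs ++ zs′ , ++⁺ zs∈ zs′∈ , O.∧-greatest (O.trans ≤zs ≤u) (O.trans ≤zs′ ≤v)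

    x∈Generated : Generated x
    x∈Generated = [] , [] , O.refl

    y∉Generated : ¬ Generated y
    y∉Generated (zs , zs∈ , ≤y) = Tower-consistent x≰y Tower-top zs zs∈ ≤y

    top⊆Generated : ∀ {u} → u ∈ top → Generated u
    top⊆Generated u∈ = _ ∷ [] , u∈ ∷ [] , O.x∧y≤x _ _

    -- By idempotence all occurrences of `u` merge into one; the other entries and `x` are collected
    -- in `d`.
    factor : ∀ {u zs} → All (λ z → z ≡ u ⊎ z ∈ top) zs → ∃ λ d → Generated d × u ∧ d ≤ ⋀ zs
    factor []         = x , x∈Generated , O.x∧y≤y _ _
    factor (z∈ ∷ zs∈) with factor zs∈ | z∈
    ... | d , d∈ , ≤⋀ | inj₁ refl = d , d∈ , O.∧-greatest (O.x∧y≤x _ _) ≤⋀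
    ... | d , d∈ , ≤⋀ | inj₂ z∈top = _ , Generated-∧ (top⊆Generated z∈top) d∈ ,
      O.∧-greatest (O.trans (O.x∧y≤y _ _) (O.x∧y≤x _ _))
        (O.trans (O.∧-greatest (O.x∧y≤x _ _) (O.trans (O.x∧y≤y _ _) (O.x∧y≤y _ _))) ≤⋀)

    ∉Generated : ∀ {u} → ¬ Generated u → ∃ λ d → Generated d × u ∧ d ≤ y
    ∉Generated u∉ with inconsistent-with-top (u∉ ∘ top⊆Generated)
    ... | zs , zs∈ , ¬¬≤y with factor zs∈
    ...   | d , d∈ , ≤⋀ = d , d∈ , O.trans ≤⋀ (decidable-stable em ¬¬≤y)

    -- If both `u` and `v` were missing, maximality would give `u ∧ d ≤ y` and `v ∧ e ≤ y`;
    -- distributivity then puts `y` into the filter.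
    Generated-prime : ∀ {u v} → Generated (u ∨ v) → Generated u ⊎ Generated v
    Generated-prime {u} {v} u∨v∈ with em {P = Generated u} | em {P = Generated v}
    ... | yes u∈ | _      = inj₁ u∈
    ... | no  _  | yes v∈ = inj₂ v∈
    ... | no  u∉ | no  v∉ with ∉Generated u∉ | ∉Generated v∉
    ...   | d , d∈ , ud≤y | e , e∈ , ve≤y = ⊥-elim (y∉Generated (Generated-↑
      (O.trans (O.reflexive (∧-distribʳ-∨ (d ∧ e) u v)) (O.∨-least
        (O.trans (O.∧-greatest (O.x∧y≤x _ _) (O.trans (O.x∧y≤y _ _) (O.x∧y≤x _ _))) ud≤y)
        (O.trans (O.∧-greatest (O.x∧y≤x _ _) (O.trans (O.x∧y≤y _ _) (O.x∧y≤y _ _))) ve≤y)))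
      (Generated-∧ u∨v∈ (Generated-∧ d∈ e∈))))

    separating : PrimeFilter A
    separating = record
      { filter        = Generated
      ; isPrimeFilter = record
        { inhabited    = x , x∈Generated
        ; upwardClosed = Generated-↑
        ; ∧-closed     = Generated-∧
        ; proper       = λ all → y∉Generated (all y)
        ; prime        = Generated-prime
        }
      }

  prime-filter-theorem : ∀ {x y} → ¬ x ≤ y →
    ∃ λ (P : PrimeFilter A) → PrimeFilter.filter P x × ¬ PrimeFilter.filter P y
  prime-filter-theorem x≰y = separating x≰y , x∈Generated x≰y , y∉Generated x≰y

-- The image of a homomorphism as a subalgebra.

module Image {A : ŁukasiewiczAlgebra₃ a ℓ₁} {B : ŁukasiewiczAlgebra₃ b ℓ₂}
             {f : ŁukasiewiczAlgebra₃.Carrier A → ŁukasiewiczAlgebra₃.Carrier B}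
             (f-homo : IsŁukasiewiczHomomorphism A B f) where
  private
    module A = ŁukasiewiczAlgebra₃ A
    module B = ŁukasiewiczAlgebra₃ B
  open IsŁukasiewiczHomomorphism f-homo
  open IsLatticeHomomorphism isLatticeHomomorphism using (⟦⟧-cong; ∧-homo; ∨-homo)

  image : Subalgebra B (a ⊔ ℓ₂)
  image = record
    { U       = λ y → ∃ λ x → f x B.≈ y
    ; respect = λ y≈z (x , fx≈y) → x , B.trans fx≈y y≈z
    ; ∨-mem   = λ (x , p) (y , q) → x A.∨ y , B.trans (∨-homo x y) (B.∨-cong p q)
    ; ∧-mem   = λ (x , p) (y , q) → x A.∧ y , B.trans (∧-homo x y) (B.∧-cong p q)
    ; ∼-mem   = λ (x , p) → A.∼ x , B.trans (∼-homo x) (B.∼-cong p)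
    ; ∇-mem   = λ (x , p) → A.∇ x , B.trans (∇-homo x) (B.∇-cong p)
    ; ⊤-mem   = A.⊤ , ⊤-homo
    }

  isomorphic-image : Injective A._≈_ B._≈_ f → Isomorphic A (subalgebra B image)
  isomorphic-image f-inj = (λ x → f x , x , B.refl) , record
    { isŁukasiewiczHomomorphism = record
      { isLatticeHomomorphism = record
        { isRelHomomorphism = record { cong = ⟦⟧-cong }
        ; ∧-homo            = ∧-homo
        ; ∨-homo            = ∨-homo
        }
      ; ∼-homo = ∼-homo
      ; ∇-homo = ∇-homo
      ; ⊤-homo = ⊤-homo
      }
    ; injective  = f-inj
    ; surjective = λ (y , x , fx≈y) → x , λ z≈x → B.trans (⟦⟧-cong z≈x) fx≈y
    }

-- Comparable prime filters and the meaning of `∇`.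

module Representation (em : ∀ {ℓ} → ExcludedMiddle ℓ)
                      (funext : ∀ {a b} → Extensionality a b)
                      (A : ŁukasiewiczAlgebra₃ c ℓ) (P₀ : PrimeFilter A) where
  open ŁukasiewiczAlgebra₃ A
  open PrimeFilterProperties A
  open PrimeFilterTheorem em funext A using (prime-filter-theorem)
  open PrimeFilter
  open RoughSets em (primeFilterSpace A em P₀)
    using (Subset; RoughSet; _≈ʳ_; _∧ʳ_; _∨ʳ_; ∼ʳ_; ∇ʳ_; ⊤ʳ; ¬ˢ_; ∈M; ∈M⁻; lower-∼; upper-∼; ¬∩)
  private
    module O = OrderLattice.Lattice
      (DistributiveLatticeProperties.∨-∧-orderTheoreticLattice distributiveLattice)
    PF = PrimeFilter A
    _~_ = Comparable A

    dne : ∀ {ℓ} {P : Set ℓ} → ¬ ¬ P → P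
    dne = decidable-stable em

  ∼-∨ : ∀ x y → ∼ (x ∨ y) ≈ ∼ x ∧ ∼ y
  ∼-∨ x y = trans (∼-cong (sym (trans (deMorgan (∼ x) (∼ y))
    (∨-cong (∼-involutive x) (∼-involutive y))))) (∼-involutive _)

  -- The Białynicki-Birula-Rasiowa involution on prime filters of a De Morgan algebra.
  dual : PF → PF
  dual P = record
    { filter        = λ x → ¬ filter P (∼ x)
    ; isPrimeFilter = record
      { inhabited    = ⊤ , ∼⊤∉ P
      ; upwardClosed = λ x≤y ∼x∉ → ∼x∉ ∘ upwardClosed P (∼-anti x≤y)
      ; ∧-closed     = λ ∼x∉ ∼y∉ → [ ∼x∉ , ∼y∉ ]′ ∘ prime P ∘ resp P (deMorgan _ _)
      ; proper       = λ all → all (∼ ⊤) (resp P (sym (∼-involutive ⊤)) (⊤∈ P))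
      ; prime        = λ ∼x∨y∉ → ¬∩ λ (∼x∈ , ∼y∈) →
                         ∼x∨y∉ (resp P (sym (∼-∨ _ _)) (∧-closed P ∼x∈ ∼y∈))
      }
    }

  -- If `P` contains no pair `x`, `∼ x`, it lies inside its dual. If it contains one, Kleene's law
  -- puts `y` or `∼ y` into `P` for every `y`, which gives the reverse inclusion.
  dual-comparable : ∀ P → P ~ dual P
  dual-comparable P with em {P = ∃ λ x → filter P x × filter P (∼ x)}
  ... | no  ∄ = inj₁ λ x∈ ∼x∈ → ∄ (_ , x∈ , ∼x∈)
  ... | yes (x , x∈ , ∼x∈) = inj₂ λ {y} ∼y∉ → dne λ y∉ →
    kleene P x∈ ∼x∈ y∉ ∼y∉ (upwardClosed P ≤∇ ∼x∈)
      (upwardClosed P (∇-mono (O.reflexive (∼-involutive y))) (∇∼ P ∼y∉))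

  -- If `P` misses `x`, then `dual P` contains it: `∼ x` and `∇ x` together in `P` would force `x`
  -- into `P`.
  ∇∈⁻ : ∀ P {x} → filter P (∇ x) → ∃ λ Q → P ~ Q × filter Q x
  ∇∈⁻ P {x} ∇x∈ with em {P = filter P x}
  ... | yes x∈ = P , inj₁ id , x∈
  ... | no  x∉ = dual P , dual-comparable P , λ ∼x∈ → x∉ (∼∇ P ∼x∈ ∇x∈)

  ∇∈⁺ : ∀ P Q {x} → P ~ Q → filter Q x → filter P (∇ x)
  ∇∈⁺ P Q P~Q x∈Q = ∇-transfer Q P (Comparable-sym P Q P~Q) (upwardClosed Q ≤∇ x∈Q)

  ∇∼∈⁻ : ∀ P {x} → filter P (∇ ∼ x) → ∃ λ Q → P ~ Q × ¬ filter Q x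
  ∇∼∈⁻ P {x} ∇∼x∈ with em {P = filter P x}
  ... | no  x∉ = P , inj₁ id , x∉
  ... | yes x∈ = dual P , dual-comparable P , λ ∼x∉ →
    ∼x∉ (∼∇ P (resp P (sym (∼-involutive x)) x∈) ∇∼x∈)

  ∇∼∈⁺ : ∀ P Q {x} → P ~ Q → ¬ filter Q x → filter P (∇ ∼ x)
  ∇∼∈⁺ P Q P~Q x∉Q = ∇-transfer Q P (Comparable-sym P Q P~Q) (∇∼ Q x∉Q)

  -- Primeness is applied to `x ∨ y` itself, in a comparable filter `Q`, and the result is carried
  -- back to `P`.
  ∇∨∈ : ∀ P {x y} → filter P (∇ (x ∨ y)) → filter P (∇ x) ⊎ filter P (∇ y)
  ∇∨∈ P ∇x∨y∈ with ∇∈⁻ P ∇x∨y∈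
  ... | Q , P~Q , x∨y∈Q = Sum.map (∇∈⁺ P Q P~Q) (∇∈⁺ P Q P~Q) (prime Q x∨y∈Q)

  ∇∧∼∇∉ : ∀ P {x} → filter P (∇ x) → ¬ filter P (∼ ∇ x)
  ∇∧∼∇∉ P ∇x∈ ∼∇x∈ = ∼⊤∉ P (upwardClosed P ∇∧∼∇≤∼⊤ (∧-closed P ∇x∈ ∼∇x∈))

  ∇∼∇∉ : ∀ P {x} → filter P (∇ x) → ¬ filter P (∇ ∼ ∇ x)
  ∇∼∇∉ P ∇x∈ ∇∼∇x∈ with ∇∈⁻ P ∇∼∇x∈
  ... | Q , P~Q , ∼∇x∈Q = ∇∧∼∇∉ Q (∇-transfer P Q P~Q ∇x∈) ∼∇x∈Q

  -- The homomorphism into the algebra of rough sets.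

  containing : Carrier → Subset
  containing x = record
    -- `Lift` raises membership to the universe level that subsets of the space of prime filters
    -- require.
    { pred    = λ P → Lift _ (filter P x)
    ; respect = λ (P⊆Q , _) (lift x∈P) → lift (P⊆Q x∈P)
    }

  -- Both approximations are stored in closed form, so that the homomorphism laws compare
  -- memberships in a single `P`.
  rough : Carrier → RoughSet
  rough x = record
    { lower     = ¬ˢ containing (∇ ∼ x)
    ; upper     = containing (∇ x)
    ; generator = X
    ; isLower   =
        (λ {P} ∉ P∈M¬X → let Q , P~Q , x∉Q = ∈M⁻ (¬ˢ X) {P} P∈M¬X in
           ∉ (lift (∇∼∈⁺ P Q P~Q (x∉Q ∘ lift)))) ,
        (λ {P} ∉M¬X (lift ∇∼x∈P) → let Q , P~Q , x∉Q = ∇∼∈⁻ P ∇∼x∈P in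
           ∉M¬X (∈M (¬ˢ X) {P} {Q} P~Q (x∉Q ∘ lower)))
    ; isUpper   =
        (λ {P} (lift ∇x∈P) → let Q , P~Q , x∈Q = ∇∈⁻ P ∇x∈P in ∈M X {P} {Q} P~Q (lift x∈Q)) ,
        (λ {P} P∈MX → let Q , P~Q , x∈Q = ∈M⁻ X {P} P∈MX in lift (∇∈⁺ P Q P~Q (lower x∈Q)))
    }
    where X = containing x

  rough-cong : ∀ {x y} → x ≈ y → rough x ≈ʳ rough y
  rough-cong x≈y =
    ((λ {P} ∉ (lift h) → ∉ (lift (resp P (∇-cong (∼-cong (sym x≈y))) h))) ,
     (λ {P} ∉ (lift h) → ∉ (lift (resp P (∇-cong (∼-cong x≈y)) h)))) ,
    ((λ {P} (lift h) → lift (resp P (∇-cong x≈y) h)) ,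
     (λ {P} (lift h) → lift (resp P (∇-cong (sym x≈y)) h)))

  -- The upper parts agree by `∇-∧`. In the lower parts `∼` turns the meet into a join, which calls
  -- for `∇∨∈`; for `rough-∨` the roles are exchanged.
  rough-∧ : ∀ x y → rough (x ∧ y) ≈ʳ rough x ∧ʳ rough y
  rough-∧ x y =
    ((λ {P} ∉ →
        (λ (lift h) → ∉ (lift (upwardClosed P (∇-mono (∼-anti (O.x∧y≤x x y))) h))) ,
        (λ (lift h) → ∉ (lift (upwardClosed P (∇-mono (∼-anti (O.x∧y≤y x y))) h)))) ,
     (λ {P} (∼x∉ , ∼y∉) (lift h) →
        [ ∼x∉ ∘ lift , ∼y∉ ∘ lift ]′ (∇∨∈ P (resp P (∇-cong (deMorgan x y)) h)))) ,
    ((λ {P} (lift h) →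
        lift (upwardClosed P (∇-mono (O.x∧y≤x x y)) h) ,
        lift (upwardClosed P (∇-mono (O.x∧y≤y x y)) h)) ,
     (λ {P} (lift h , lift k) → lift (resp P (sym (∇-∧ x y)) (∧-closed P h k))))

  rough-∨ : ∀ x y → rough (x ∨ y) ≈ʳ rough x ∨ʳ rough y
  rough-∨ x y =
    ((λ {P} ∉ → ¬∩ λ (lift h , lift k) →
        ∉ (lift (resp P (sym (trans (∇-cong (∼-∨ x y)) (∇-∧ (∼ x) (∼ y)))) (∧-closed P h k)))) ,
     (λ {P} → [ (λ ∉ (lift h) → ∉ (lift (upwardClosed P (∇-mono (∼-anti (O.x≤x∨y x y))) h)))
              , (λ ∉ (lift h) → ∉ (lift (upwardClosed P (∇-mono (∼-anti (O.y≤x∨y x y))) h))) ]′)) ,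
    ((λ {P} (lift h) → Sum.map lift lift (∇∨∈ P h)) ,
     (λ {P} → [ (λ (lift h) → lift (upwardClosed P (∇-mono (O.x≤x∨y x y)) h))
              , (λ (lift h) → lift (upwardClosed P (∇-mono (O.y≤x∨y x y)) h)) ]′))

  rough-∼ : ∀ x → rough (∼ x) ≈ʳ ∼ʳ rough x
  rough-∼ x =
    ((λ {P} ∉ → proj₂ (lower-∼ (rough x)) {P} λ (lift h) →
        ∉ (lift (resp P (∇-cong (sym (∼-involutive x))) h))) ,
     (λ {P} ∈ (lift h) → proj₁ (lower-∼ (rough x)) {P} ∈ (lift (resp P (∇-cong (∼-involutive x)) h)))) ,
    ((λ {P} h → proj₂ (upper-∼ (rough x)) {P} λ ∉ → ∉ h) ,
     (λ {P} ∈ → dne (proj₁ (upper-∼ (rough x)) {P} ∈)))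

  rough-∇ : ∀ x → rough (∇ x) ≈ʳ ∇ʳ rough x
  rough-∇ x =
    ((λ {P} ∉ → lift ([ (λ h → ⊥-elim (∉ (lift (upwardClosed P ≤∇ h)))) , id ]′ (∇-or P x))) ,
     (λ {P} (lift h) (lift k) → ∇∼∇∉ P h k)) ,
    ((λ {P} (lift h) → let Q , P~Q , ∇x∈Q = ∇∈⁻ P h in
        lift (∇-transfer Q P (Comparable-sym P Q P~Q) ∇x∈Q)) ,
     (λ {P} (lift h) → lift (upwardClosed P ≤∇ h)))

  rough-⊤ : rough ⊤ ≈ʳ ⊤ʳ
  rough-⊤ =
    ((λ _ → tt) , (λ {P} _ (lift h) → ∼⊤∉ P (upwardClosed P ∇∼⊤≤∼⊤ h))) ,
    ((λ _ → tt) , (λ {P} _ → lift (upwardClosed P ≤∇ (⊤∈ P))))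

  rough-isHomomorphism :
    IsŁukasiewiczHomomorphism A (roughSetAlgebra em (primeFilterSpace A em P₀)) rough
  rough-isHomomorphism = record
    { isLatticeHomomorphism = record
      { isRelHomomorphism = record { cong = rough-cong }
      ; ∧-homo            = rough-∧
      ; ∨-homo            = rough-∨
      }
    ; ∼-homo = rough-∼
    ; ∇-homo = rough-∇
    ; ⊤-homo = rough-⊤
    }

  -- Injectivity and the representation theorem.

  rough-reflects-≤ : ∀ {x y} → rough x ≈ʳ rough y → x ≤ y
  rough-reflects-≤ {x} {y} ((lower⊆ , _) , (upper⊆ , _)) = dne λ x≰y →
    let P , x∈P , y∉P = prime-filter-theorem x≰y
        ∇y∈P  = lower (upper⊆ {P} (lift (upwardClosed P ≤∇ x∈P)))
        -- Since `P` misses `y`, it contains `∇ ∼ y` and so lies outside the lower approximation of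
        -- `rough y`, hence outside that of `rough x`.
        ∇∼x∈P = dne λ ∇∼x∉P → lower⊆ {P} (∇∼x∉P ∘ lower) (lift (∇∼ P y∉P))
        ∼x∈P  = ∼∇ P (resp P (sym (∼-involutive x)) x∈P) ∇∼x∈P
        ∼y∉P  = λ ∼y∈P → y∉P (∼∇ P ∼y∈P ∇y∈P)
    in kleene P x∈P ∼x∈P y∉P ∼y∉P ∇∼x∈P ∇y∈P

  rough-injective : Injective _≈_ _≈ʳ_ rough
  rough-injective {x} {y} ρ≈σ = O.antisym (rough-reflects-≤ ρ≈σ)
    (rough-reflects-≤ (ŁukasiewiczAlgebra₃.sym (roughSetAlgebra em (primeFilterSpace A em P₀))
      {rough x} {rough y} ρ≈σ))

theorem3p2 : (em : ∀ {a} → ExcludedMiddle a) →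
    (funext : ∀ {a b} → Extensionality a b) →
    ∀ {c ℓ} (A : ŁukasiewiczAlgebra₃ c ℓ) (P₀ : PrimeFilter A) →
    ∃ λ (B : Subalgebra (roughSetAlgebra em (primeFilterSpace A em P₀)) (suc (c ⊔ ℓ))) →
    Isomorphic A (subalgebra (roughSetAlgebra em (primeFilterSpace A em P₀)) B)
theorem3p2 em funext A P₀ = image , isomorphic-image rough-injective
  where
  open Representation em funext A P₀
  open Image rough-isHomomorphism
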